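{- There exists $n_0$ such that for all $n \ge n_0$ the following holds. Let $L \colon \mathbb{F}_2^n \to \mathbb{F}_2^n$ be an invertible linear map, let $x_1, x_2 \in \mathbb{F}_2^n$, let $r < n/2 - 7$, and set $A_1 = B_r(x_1)$ and $A_2 = L B_r(x_2)$. Suppose that $S \subseteq \mathbb{F}_2^n$ satisfies $\mathbb{F}_2^n = A_1 \cup A_2 \cup S$. Then $S + S = \mathbb{F}_2^n$.
   Context: For $x, y \in \mathbb{F}_2^n$, $d(x,y)$ denotes the Hamming distance, i.e. the number of indices $i \in \{1,\dots,n\}$ with $x_i \neq y_i$. For a real number $r$, $B_r(x) = \{y \in \mathbb{F}_2^n : d(x,y) \le r\}$ is the Hamming ball of radius $r$ around $x$. For a linear map $L \colon \mathbb{F}_2^n \to \mathbb{F}_2^n$, $L B_r(x) = \{Ly : y \in B_r(x)\}$. For $A, B \subseteq \mathbb{F}_2^n$, $A + B = \{a + b : a \in A, b \in B\}$. -}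

module Defs where

open import Algebra.Module.Bundles.Raw using (RawLeftModule)
open import Data.Bool using (Bool; false; _∧_; _xor_; _≟_)
open import Data.Integer using (+_)
open import Data.Nat using (ℕ)
open import Data.Product using (_×_; _,_; ∃-syntax)
open import Data.Rational using (ℚ; _<_; _/_)
open import Data.Sum using (_⊎_)
open import Data.Vec using (Vec; count; map; replicate; zip; zipWith)
open import Function using (_⇔_; id)
open import Level using (0ℓ)
open import Relation.Binary.PropositionalEquality using (_≡_)
open import Relation.Nullary using (¬_)
open import Relation.Nullary.Decidable using (¬?)
open import Relation.Unary using (Pred; _∈_)

-- The real numbers, as two-sided Dedekind cuts of ℚ: `lower p` means p < r and
-- `upper q` means r < q.
record ℝ : Set₁ where
  field
    lower upper     : Pred ℚ 0ℓ
    lower-inhabited : ∃[ p ] lower p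
    upper-inhabited : ∃[ q ] upper q
    lower-rounded   : ∀ p → lower p ⇔ (∃[ p′ ] p < p′ × lower p′)
    upper-rounded   : ∀ q → upper q ⇔ (∃[ q′ ] q′ < q × upper q′)
    disjoint        : ∀ q → ¬ (lower q × upper q)
    located         : ∀ p q → p < q → lower p ⊎ upper q

infix 4 _<ℝ_ _≤ℝ_

_<ℝ_ : ℝ → ℚ → Set
r <ℝ q = ℝ.upper r q

_≤ℝ_ : ℚ → ℝ → Set
q ≤ℝ r = ¬ (r <ℝ q)

-- The field 𝔽₂ is Bool, with addition _xor_ and multiplication _∧_.
𝔽₂^_ : ℕ → Set
𝔽₂^ n = Vec Bool n

infixl 6 _+ⱽ_

_+ⱽ_ : ∀ {n} → 𝔽₂^ n → 𝔽₂^ n → 𝔽₂^ n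
_+ⱽ_ = zipWith _xor_

-- Negation is the identity in characteristic 2.
𝔽₂^-rawLeftModule : ℕ → RawLeftModule Bool 0ℓ 0ℓ
𝔽₂^-rawLeftModule n = record
  { Carrierᴹ = 𝔽₂^ n
  ; _≈ᴹ_     = _≡_
  ; _+ᴹ_     = _+ⱽ_
  ; _*ₗ_     = λ c → map (c ∧_)
  ; 0ᴹ       = replicate n false
  ; -ᴹ_      = id
  }

d : ∀ {n} → 𝔽₂^ n → 𝔽₂^ n → ℕ
d x y = count (λ (a , b) → ¬? (a ≟ b)) (zip x y)

B : ∀ {n} → ℝ → 𝔽₂^ n → Pred (𝔽₂^ n) 0ℓ
B r x y = (+ d x y) / 1 ≤ℝ r

image : ∀ {n} → (𝔽₂^ n → 𝔽₂^ n) → Pred (𝔽₂^ n) 0ℓ → Pred (𝔽₂^ n) 0ℓ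
image L P z = ∃[ y ] (y ∈ P × L y ≡ z)

infixl 6 _⊕_

_⊕_ : ∀ {n} → Pred (𝔽₂^ n) 0ℓ → Pred (𝔽₂^ n) 0ℓ → Pred (𝔽₂^ n) 0ℓ
(P ⊕ Q) z = ∃[ a ] ∃[ b ] (a ∈ P × b ∈ Q × a +ⱽ b ≡ z)

{-# OPTIONS --safe #-}
module Submission where

-- Put M = L⁻¹.  For each z we need a vector a such that a and a + z are far from x₁ while
-- M a and M (a + z) are far from x₂.  The n coordinates of a and the n coordinates of M a
-- fall into four classes, according to the side (a or M a) and to the value ("colour") of
-- the coordinate at z.  If two coordinates of one class are paired and a is chosen so that
-- a + x₁ (resp. M a + x₂) takes different values on them, the same holds with a + z in place
-- of a, and the pair contributes exactly 1 to the distance.  So it suffices to pair up, inside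
-- the classes, all but at most 14 coordinates of each side such that the functionals
-- "difference of the two coordinates" of the pairs are linearly independent.
--
-- Such a pairing is found by descent.  If a class C with three free coordinates has two
-- coordinates that differ at some vector killed by all pairs, then C can receive one more pair,
-- possibly after re-pairing one old pair.  Let 𝒞 consist of the classes with at least θ free
-- coordinates.  A dimension count yields a vector killed by the pairs inside 𝒞 and nonconstant
-- on some C in 𝒞.  Hence C gains a pair, at the cost of at most one pair from a class D outside
-- 𝒞.  If θ is chosen so that D had at least three fewer free coordinates than C, this lowers
-- the number of unordered pairs of free coordinates of equal class.

open import Defs
open import Algebra.Module.Morphism.Structures using (IsLeftModuleIsomorphism)
open import Data.Integer using (+_)
open import Data.Nat using (ℕ; _≥_)
open import Data.Product using (∃-syntax)
open import Data.Rational using (_/_; _-_)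
open import Level using (0ℓ)
open import Relation.Unary using (Pred; U; _∪_; _≐_)
open import Data.Bool using (Bool; true; false; not; _∧_; _xor_; if_then_else_)
open import Data.Bool.Properties using (xor-same; xor-comm; ¬-not)
import Data.Bool.Properties as Bool
open import Data.Empty using (⊥; ⊥-elim)
open import Data.Fin using (Fin; zero; suc; combine; toℕ)
import Data.Fin.Properties as Fin
open import Data.List using (List; []; _∷_; _++_; map; length; allFin; filter; take; tabulate)
open import Data.List.Membership.Propositional using (_∈_)
open import Data.List.Membership.Propositional.Properties using (∈-∃++; ∈-++⁺ˡ; ∈-++⁺ʳ; ∈-++⁻; ∈-map⁺; ∈-allFin; ∈-filter⁺; ∈-filter⁻)
open import Data.List.Relation.Binary.Permutation.Propositional using (_↭_; refl; prep; swap; trans; ↭-refl; ↭-sym; ↭-trans; ↭-prep; ↭-swap)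
open import Data.List.Relation.Binary.Permutation.Propositional.Properties using (All-resp-↭; ∈-resp-↭; ++⁺; ++⁺ˡ; ++⁺ʳ; shift; shifts; drop-∷; map⁺; ¬x∷xs↭[])
open import Data.List.Relation.Unary.All as All using (All; []; _∷_)
open import Data.List.Properties using (++-identityʳ; length-map; length-++; length-tabulate; length-take; map-cong; map-∘; map-tabulate)
open import Data.List.Relation.Unary.All.Properties using (++⁻ˡ; ++⁻ʳ; map⁻)
open import Data.List.Relation.Unary.Any using (here; there)
open import Data.Nat using (zero; suc; _+_; _*_; _^_; _≤_; _<_; z≤n; s≤s)
open import Data.Nat.ListAction using (sum)
open import Data.Nat.ListAction.Properties using (sum-↭)
import Data.Nat.Properties as ℕ
open import Data.Nat.Induction using (<-wellFounded)
open import Data.Nat.Tactic.RingSolver using (solve-∀)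
open import Data.Product using (Σ; ∃₂; _×_; _,_; proj₁; proj₂)
open import Data.Product.Properties using (≡-dec)
open import Data.Sum using (_⊎_; inj₁; inj₂; [_,_]′)
import Data.Integer as ℤ
import Data.Integer.Properties as ℤ
import Data.Rational as ℚ
import Data.Rational.Properties as ℚ
open import Data.Rational using (toℚᵘ)
open import Data.Rational.Unnormalised as ℚᵘ using (mkℚᵘ)
import Data.Rational.Unnormalised.Properties as ℚᵘ
open import Data.Unit using (tt)
import Data.Vec.Properties as Vec
open import Data.Vec as Vec using (Vec; []; _∷_)
open import Function using (_∘_; Equivalence)
open import Relation.Binary.PropositionalEquality as ≡ using (_≡_; _≢_; refl; sym; cong; cong₂; subst; module ≡-Reasoning)
open import Relation.Nullary using (¬_; Dec; yes; no; does; contradiction)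
open import Relation.Nullary.Decidable using (_⊎-dec_; dec-true; dec-false)
open import Induction.WellFounded using (Acc; acc)

private
  variable
    A : Set

-- Decisions, permutations and counting in lists

does-true : (a? : Dec A) → does a? ≡ true → A
does-true (yes a) _ = a

does-false : (a? : Dec A) → does a? ≡ false → ¬ A
does-false (no ¬a) _ = ¬a

pick : ∀ {x : A} {xs} → x ∈ xs → ∃[ ys ] xs ↭ x ∷ ys
pick x∈xs with ys , zs , refl ← ∈-∃++ x∈xs = ys ++ zs , shift _ ys zs

uncons-↭ : ∀ {x y : A} {xs ys} → x ∷ xs ↭ y ∷ ys →
           (x ≡ y × xs ↭ ys) ⊎ (∃[ zs ] xs ↭ y ∷ zs × ys ↭ x ∷ zs)
uncons-↭ {x = x} {y} ρ with ∈-resp-↭ (↭-sym ρ) (here refl)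
... | here refl = inj₁ (refl , drop-∷ ρ)
... | there y∈xs with zs , τ ← pick y∈xs =
  inj₂ (zs , τ , drop-∷ (↭-trans (↭-sym ρ) (↭-trans (↭-prep x τ) (↭-swap x y ↭-refl))))

split : (P : A → Bool) (xs : List A) → ∃₂ λ ys zs →
        xs ↭ ys ++ zs × All (λ x → P x ≡ true) ys × All (λ x → P x ≡ false) zs
split P [] = [] , [] , ↭-refl , [] , []
split P (x ∷ xs) with ys , zs , ρ , ps , qs ← split P xs | P x in eq
... | true  = x ∷ ys , zs , ↭-prep x ρ , eq ∷ ps , qs
... | false = ys , x ∷ zs , ↭-trans (↭-prep x ρ) (↭-sym (shift x ys zs)) , ps , eq ∷ qs

take₁-inhabited : ∀ {x : A} {xs} → x ∈ xs → ∃[ y ] y ∈ take 1 xs × y ∈ xs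
take₁-inhabited {xs = y ∷ _} _ = y , here refl , here refl

bit : Bool → ℕ
bit b = if b then 1 else 0

count : (A → Bool) → List A → ℕ
count P xs = sum (map (bit ∘ P) xs)

count-↭ : (P : A → Bool) {xs ys : List A} → xs ↭ ys → count P xs ≡ count P ys
count-↭ P ρ = sum-↭ (map⁺ (bit ∘ P) ρ)

count-++ : (P : A → Bool) (xs ys : List A) → count P (xs ++ ys) ≡ count P xs + count P ys
count-++ P [] ys = refl
count-++ P (x ∷ xs) ys rewrite count-++ P xs ys = sym (ℕ.+-assoc (bit (P x)) _ _)

count-none : (P : A → Bool) {xs : List A} → All (λ x → P x ≡ false) xs → count P xs ≡ 0
count-none P [] = refl
count-none P (eq ∷ eqs) rewrite eq = count-none P eqs

count-not : (P : A → Bool) (xs : List A) → count P xs + count (not ∘ P) xs ≡ length xs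
count-not P [] = refl
count-not P (x ∷ xs) with P x
... | true  = cong suc (count-not P xs)
... | false = ≡.trans (ℕ.+-suc _ _) (cong suc (count-not P xs))

count-mono : {P Q : A → Bool} → (∀ x → P x ≡ true → Q x ≡ true) →
             (xs : List A) → count P xs ≤ count Q xs
count-mono P⇒Q [] = z≤n
count-mono {P = P} {Q} P⇒Q (x ∷ xs) with P x in eq
... | true rewrite P⇒Q x eq = s≤s (count-mono P⇒Q xs)
... | false = ℕ.≤-trans (count-mono P⇒Q xs) (ℕ.m≤n+m _ (bit (Q x)))

count-cover : {P Q R : A → Bool} → (∀ x → P x ≡ true → Q x ≡ true ⊎ R x ≡ true) →
              (xs : List A) → count P xs ≤ count Q xs + count R xs
count-cover P⇒ [] = z≤n
count-cover {P = P} {Q} {R} P⇒ (x ∷ xs) = begin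
  bit (P x) + count P xs                             ≤⟨ ℕ.+-mono-≤ bits (count-cover P⇒ xs) ⟩
  (bit (Q x) + bit (R x)) + (count Q xs + count R xs) ≡⟨ interchange (bit (Q x)) (bit (R x)) _ _ ⟩
  count Q (x ∷ xs) + count R (x ∷ xs)                ∎
  where
  open ℕ.≤-Reasoning
  interchange : ∀ a b c e → (a + b) + (c + e) ≡ (a + c) + (b + e)
  interchange = solve-∀
  bits : bit (P x) ≤ bit (Q x) + bit (R x)
  bits with P x in eq
  ... | false = z≤n
  ... | true with P⇒ x eq
  ...   | inj₁ q rewrite q = s≤s z≤n
  ...   | inj₂ r rewrite r = ℕ.m≤n+m 1 (bit (Q x))

count-map : ∀ {A′ : Set} (P : A → Bool) (g : A′ → A) (xs : List A′) →
            count P (map g xs) ≡ count (P ∘ g) xs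
count-map P g xs = cong sum (sym (map-∘ xs))

count-pick : (P : A → Bool) (xs : List A) {k : ℕ} → suc k ≤ count P xs →
             ∃₂ λ x ys → P x ≡ true × xs ↭ x ∷ ys × k ≤ count P ys
count-pick P (x ∷ xs) k< with P x in eq
... | true  = x , xs , eq , ↭-refl , ℕ.≤-pred k<
... | false with y , ys , Py , ρ , k≤ ← count-pick P xs k< =
  y , x ∷ ys , Py , ↭-trans (↭-prep x ρ) (↭-swap x y ↭-refl) ,
  subst (λ b → _ ≤ bit b + count P ys) (sym eq) k≤

flat : List (A × A) → List A
flat [] = []
flat ((i , j) ∷ ps) = i ∷ j ∷ flat ps

flat-↭ : {ps qs : List (A × A)} → ps ↭ qs → flat ps ↭ flat qs
flat-↭ refl = ↭-refl
flat-↭ (prep (i , j) ρ) = ↭-prep i (↭-prep j (flat-↭ ρ))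
flat-↭ (swap (i , j) (k , l) ρ) =
  ↭-trans (shifts (i ∷ j ∷ []) (k ∷ l ∷ [])) (++⁺ˡ (k ∷ l ∷ i ∷ j ∷ []) (flat-↭ ρ))
flat-↭ (trans ρ τ) = ↭-trans (flat-↭ ρ) (flat-↭ τ)

flat-++ : (ps qs : List (A × A)) → flat (ps ++ qs) ≡ flat ps ++ flat qs
flat-++ [] qs = refl
flat-++ ((i , j) ∷ ps) qs = cong (λ xs → i ∷ j ∷ xs) (flat-++ ps qs)

∈-flat⁻ : ∀ {i : A} (ps : List (A × A)) → i ∈ flat ps →
          ∃[ j ] ((i , j) ∈ ps ⊎ (j , i) ∈ ps)
∈-flat⁻ ((i , j) ∷ ps) (here refl) = j , inj₁ (here refl)
∈-flat⁻ ((i , j) ∷ ps) (there (here refl)) = i , inj₂ (here refl)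
∈-flat⁻ (_ ∷ ps) (there (there i∈)) with ∈-flat⁻ ps i∈
... | j , inj₁ m = j , inj₁ (there m)
... | j , inj₂ m = j , inj₂ (there m)

-- Pigeonhole arguments: colliding vectors and thresholds

bitToFin : Bool → Fin 2
bitToFin false = zero
bitToFin true  = suc zero

encode : ∀ {m} → Vec Bool m → Fin (2 ^ m)
encode []      = zero
encode (b ∷ v) = combine (bitToFin b) (encode v)

bitToFin-injective : ∀ {b c} → bitToFin b ≡ bitToFin c → b ≡ c
bitToFin-injective {false} {false} _ = refl
bitToFin-injective {true}  {true}  _ = refl

encode-injective : ∀ {m} {u v : Vec Bool m} → encode u ≡ encode v → u ≡ v
encode-injective {u = []} {[]} _ = refl
encode-injective {u = b ∷ u} {c ∷ v} eq =
  cong₂ _∷_ (bitToFin-injective (Fin.combine-injectiveˡ (bitToFin b) (encode u) (bitToFin c) (encode v) eq))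
            (encode-injective (Fin.combine-injectiveʳ (bitToFin b) (encode u) (bitToFin c) (encode v) eq))

encode-surjective : ∀ m (k : Fin (2 ^ m)) → Σ (Vec Bool m) λ v → encode v ≡ k
encode-surjective zero zero = [] , refl
encode-surjective (suc m) k with Fin.combine-surjective {2} {2 ^ m} k
... | zero , j , refl with v , refl ← encode-surjective m j = false ∷ v , refl
... | suc zero , j , refl with v , refl ← encode-surjective m j = true ∷ v , refl

collision : ∀ {m n} → m < n → (f : Vec Bool n → Vec Bool m) → ∃₂ λ a b → a ≢ b × f a ≡ f b
collision {m} {n} m<n f
  with k , l , k<l , eq ← Fin.pigeonhole (ℕ.^-monoʳ-< 2 (s≤s (s≤s z≤n)) m<n)
                            (encode ∘ f ∘ proj₁ ∘ encode-surjective n)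
  = _ , _ , distinct , encode-injective eq
  where
  distinct : proj₁ (encode-surjective n k) ≢ proj₁ (encode-surjective n l)
  distinct a≡b = Fin.<⇒≢ k<l (≡.trans (sym (proj₂ (encode-surjective n k)))
                   (≡.trans (cong encode a≡b) (proj₂ (encode-surjective n l))))

-- Stands in for rank-nullity. The functionals need not be linear: fewer than `n` of them take fewer
-- than `2 ^ n` value vectors. For additive ones, the sum of two colliding vectors is a nonzero
-- vector of the kernel.
values-collision : ∀ {n} (fs : List (𝔽₂^ n → Bool)) → length fs < n →
                   ∃₂ λ a b → a ≢ b × All (λ f → f a ≡ f b) fs
values-collision {n} fs len<
  with a , b , a≢b , eq ← collision len< (λ a → Vec.map (λ f → f a) (Vec.fromList fs)) =
  a , b , a≢b , agree fs eq
  where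
  agree : ∀ {a b : 𝔽₂^ n} (fs : List (𝔽₂^ n → Bool)) → Vec.map (λ f → f a) (Vec.fromList fs) ≡ Vec.map (λ f → f b) (Vec.fromList fs) →
          All (λ f → f a ≡ f b) fs
  agree [] _ = []
  agree (f ∷ fs) eq = cong Vec.head eq ∷ agree fs (cong Vec.tail eq)

-- Excludes only θ - 1 and θ - 2, so sizes on opposite sides of the threshold differ by at least
-- three, the margin that `energy-moved` needs.
Clear : ℕ → ℕ → Set
Clear θ x = θ ≤ x ⊎ x + 3 ≤ θ

clear? : ∀ θ x → Dec (Clear θ x)
clear? θ x = (θ ℕ.≤? x) ⊎-dec (x + 3 ℕ.≤? θ)

-- Each x is unclear for at most one of the thresholds 3, 5, 7, …
clear-threshold : ∀ {k} (f : Fin k → ℕ) →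
                  Σ (Fin (suc k)) λ j → ∀ i → Clear (3 + (toℕ j + toℕ j)) (f i)
clear-threshold {k} f with Fin.any? (λ j → Fin.all? (λ i → clear? (3 + (toℕ j + toℕ j)) (f i)))
... | yes found = found
... | no none =
  let j , j′ , j<j′ , eq = Fin.pigeonhole (ℕ.n<1+n k) (λ j → proj₁ (blocked j))
  in ⊥-elim (once j<j′ (proj₂ (blocked j))
       (subst (λ i → ¬ Clear (3 + (toℕ j′ + toℕ j′)) (f i)) (sym eq) (proj₂ (blocked j′))))
  where
  blocked : (j : Fin (suc k)) → ∃[ i ] ¬ Clear (3 + (toℕ j + toℕ j)) (f i)
  blocked j = Fin.¬∀⟶∃¬ k _ (λ i → clear? _ (f i)) (λ clear → none (j , clear))
  once : ∀ {s t x} → s < t → ¬ Clear (3 + (s + s)) x → ¬ Clear (3 + (t + t)) x → ⊥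
  once {s} {t} {x} s<t unclear unclear′ = unclear′ (inj₂ (begin
    x + 3               ≡⟨ ℕ.+-comm x 3 ⟩
    3 + x               ≤⟨ ℕ.+-monoʳ-≤ 2 (ℕ.≰⇒> (unclear ∘ inj₁)) ⟩
    5 + (s + s)         ≡⟨ cong (λ m → 4 + m) (ℕ.+-suc s s) ⟨
    3 + (suc s + suc s) ≤⟨ ℕ.+-monoʳ-≤ 3 (ℕ.+-mono-≤ s<t s<t) ⟩
    3 + (t + t)         ∎))
    where open ℕ.≤-Reasoning

threshold-bound : ∀ {k} (j : Fin (suc k)) → 3 + (toℕ j + toℕ j) ≤ 3 + (k + k)
threshold-bound j = ℕ.+-monoʳ-≤ 3 (ℕ.+-mono-≤ (Fin.toℕ≤pred[n] j) (Fin.toℕ≤pred[n] j))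

-- Independent functionals and their dual vectors

module Independence {X : Set} {n : ℕ} (ev : X → 𝔽₂^ n → Bool)
  (ev-+ : ∀ x a b → ev x (a +ⱽ b) ≡ ev x a xor ev x b) where

  Annihilates : 𝔽₂^ n → List X → Set
  Annihilates a xs = All (λ x → ev x a ≡ false) xs

  -- Linear independence in dual form: every member x has a vector on which x is 1
  -- and the other members vanish.
  Independent : List X → Set
  Independent xs = ∀ {x ys} → xs ↭ x ∷ ys → ∃[ b ] ev x b ≡ true × Annihilates b ys

  ev-+≡ : ∀ x {a b s t} → ev x a ≡ s → ev x b ≡ t → ev x (a +ⱽ b) ≡ s xor t
  ev-+≡ x {a} {b} refl refl = ev-+ x a b

  +-annihilates : ∀ {a b xs} → Annihilates a xs → Annihilates b xs → Annihilates (a +ⱽ b) xs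
  +-annihilates as bs = All.zipWith (λ {x} (p , q) → ev-+≡ x p q) (as , bs)

  independent-↭ : ∀ {xs ys} → xs ↭ ys → Independent xs → Independent ys
  independent-↭ ρ ind τ = ind (↭-trans ρ τ)

  independent-tail : ∀ {x xs} → Independent (x ∷ xs) → Independent xs
  independent-tail {x} ind {y} ρ
    with b , eq , _ ∷ ann ← ind (↭-trans (↭-prep x ρ) (↭-swap x y ↭-refl)) = b , eq , ann

  -- The vector `a` is dual to `x`. An old dual vector `b` with value 1 on `x` is replaced by
  -- `a +ⱽ b`, which keeps all values on `xs` because `a` vanishes there.
  independent-∷ : ∀ {x xs a} → Independent xs → Annihilates a xs → ev x a ≡ true →
                  Independent (x ∷ xs)
  independent-∷ {x} {a = a} ind ann eq ρ with uncons-↭ ρ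
  ... | inj₁ (refl , τ) = a , eq , All-resp-↭ τ ann
  ... | inj₂ (_ , τ , υ) with ind τ | All-resp-↭ τ ann
  ...   | b , yb , bs | ya ∷ as with ev x b in xb
  ...     | false = b , yb , All-resp-↭ (↭-sym υ) (xb ∷ bs)
  ...     | true  = a +ⱽ b , ev-+≡ _ ya yb ,
                    All-resp-↭ (↭-sym υ) (ev-+≡ x eq xb ∷ +-annihilates as bs)

  -- Solve for the tail first; if the value on `x` is then wrong, the dual vector of `x` flips it
  -- and nothing else.
  independent⇒solvable : ∀ xs → Independent xs → (t : X → Bool) →
                         ∃[ a ] All (λ x → ev x a ≡ t x) xs
  independent⇒solvable [] ind t = Vec.replicate n false , []
  independent⇒solvable (x ∷ xs) ind t
    with a , as ← independent⇒solvable xs (independent-tail ind) t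
       | b , xb , bs ← ind ↭-refl
       | ev x a Bool.≟ t x
  ... | yes eq = a , eq ∷ as
  ... | no neq = a +ⱽ b ,
    ≡.trans (ev-+≡ x refl xb) (≡.trans (xor-comm _ true) (sym (¬-not (neq ∘ sym)))) ∷
    All.zipWith (λ {y} (p , q) → ≡.trans (ev-+≡ y p q) (Bool.xor-identityʳ _)) (as , bs)

  -- Correct a by the dual vectors of the members of zs on which it does not vanish;
  -- if f survives, fine, and otherwise f is nonzero on one of these dual vectors.
  escape : (f : 𝔽₂^ n → Bool) → (∀ a b → f (a +ⱽ b) ≡ f a xor f b) →
           ∀ ys zs {a} → Independent (ys ++ zs) → Annihilates a ys → f a ≡ true →
           (∃[ b ] Annihilates b (ys ++ zs) × f b ≡ true) ⊎
           (∃[ x ] ∃[ xs ] ∃[ b ] x ∈ zs × ys ++ zs ↭ x ∷ xs × Annihilates b xs × f b ≡ true)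
  escape f f-+ ys [] {a} ind ann fa =
    inj₁ (a , subst (Annihilates a) (sym (++-identityʳ ys)) ann , fa)
  escape f f-+ ys (z ∷ zs) {a} ind ann fa
    with b , zb , bs ← ind (shift z ys zs) | f b in fb
  ... | true = inj₂ (z , ys ++ zs , b , here refl , shift z ys zs , bs , fb)
  ... | false = back (go (ev z a) refl)
    where
    Conclusion : List X → List X → Set
    Conclusion ys zs =
      (∃[ b ] Annihilates b (ys ++ zs) × f b ≡ true) ⊎
      (∃[ x ] ∃[ xs ] ∃[ b ] x ∈ zs × ys ++ zs ↭ x ∷ xs × Annihilates b xs × f b ≡ true)
    ind′ : Independent (z ∷ ys ++ zs)
    ind′ = independent-↭ (shift z ys zs) ind
    go : (s : Bool) → ev z a ≡ s → Conclusion (z ∷ ys) zs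
    go false za = escape f f-+ (z ∷ ys) zs ind′ (za ∷ ann) fa
    go true  za = escape f f-+ (z ∷ ys) zs ind′
      (ev-+≡ z za zb ∷ +-annihilates ann (++⁻ˡ ys bs))
      (≡.trans (f-+ a b) (cong₂ _xor_ fa fb))
    back : Conclusion (z ∷ ys) zs → Conclusion ys (z ∷ zs)
    back (inj₁ (b , bs , fb)) = inj₁ (b , All-resp-↭ (↭-sym (shift z ys zs)) bs , fb)
    back (inj₂ (x , xs , b , x∈ , ρ , bs , fb)) =
      inj₂ (x , xs , b , there x∈ , ↭-trans (shift z ys zs) ρ , bs , fb)

-- Identities for exclusive or

xor-true : ∀ x y → x xor y ≡ true → ∀ z → (x xor z ≡ true) ⊎ (y xor z ≡ true)
xor-true true  false _ true  = inj₂ refl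
xor-true true  false _ false = inj₁ refl
xor-true false true  _ true  = inj₁ refl
xor-true false true  _ false = inj₂ refl

xor-via : ∀ x y z → x xor z ≡ (x xor y) xor (y xor z)
xor-via false false z = refl
xor-via false true  z = sym (Bool.not-involutive z)
xor-via true  false z = refl
xor-via true  true  z = refl

xor-interchange : ∀ w x y z → (w xor x) xor (y xor z) ≡ (w xor y) xor (x xor z)
xor-interchange false false y     z = refl
xor-interchange false true  false z = refl
xor-interchange false true  true  z = refl
xor-interchange true  x     false z = sym (Bool.not-distribˡ-xor x z)
xor-interchange true  false true  z = Bool.not-involutive z
xor-interchange true  true  true  z = refl

-- The intended `φ (s , k)` is coordinate `k` of a for `s = false` and of M a for `s = true`;
-- `φ-separating` says that either side is a full coordinate system. `colour` stays arbitrary until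
-- `far-vector` ties it to the values at z.
module Matching {n : ℕ} (φ : Bool × Fin n → 𝔽₂^ n → Bool)
  (φ-+ : ∀ i a b → φ i (a +ⱽ b) ≡ φ i a xor φ i b)
  (φ-separating : ∀ s {a b} → (∀ k → φ (s , k) a ≡ φ (s , k) b) → a ≡ b)
  (colour : Bool × Fin n → Bool) where

  -- Classes of coordinates and partial matchings

  Index Class : Set
  Index = Bool × Fin n
  Class = Bool × Bool

  class : Index → Class
  class (s , k) = s , colour (s , k)

  _≟_ : (C D : Class) → Dec (C ≡ D)
  _≟_ = ≡-dec Bool._≟_ Bool._≟_

  within : Class → Index → Bool
  within C i = does (class i ≟ C)

  within⇒≡ : ∀ C i → within C i ≡ true → class i ≡ C
  within⇒≡ C i = does-true (class i ≟ C)

  ≡⇒within : ∀ {C} i → class i ≡ C → within C i ≡ true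
  ≡⇒within {C} i = dec-true (class i ≟ C)

  ≢⇒within : ∀ {C} i → class i ≢ C → within C i ≡ false
  ≢⇒within {C} i = dec-false (class i ≟ C)

  size : Class → List Index → ℕ
  size C = count (within C)

  side : Bool → List Index
  side s = map (s ,_) (allFin n)

  universe : List Index
  universe = side false ++ side true

  ∈-side : ∀ s k → (s , k) ∈ side s
  ∈-side s k = ∈-map⁺ (s ,_) (∈-allFin k)

  ∈-universe : ∀ i → i ∈ universe
  ∈-universe (false , k) = ∈-++⁺ˡ (∈-side false k)
  ∈-universe (true  , k) = ∈-++⁺ʳ (side false) (∈-side true k)

  gap : Index × Index → 𝔽₂^ n → Bool
  gap (i , j) a = φ i a xor φ j a

  gap-+ : ∀ p a b → gap p (a +ⱽ b) ≡ gap p a xor gap p b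
  gap-+ (i , j) a b rewrite φ-+ i a b | φ-+ j a b = xor-interchange (φ i a) (φ i b) (φ j a) (φ j b)

  open Independence gap gap-+

  Monochromatic : Index × Index → Set
  Monochromatic (i , j) = class i ≡ class j

  -- As `universe` has no repetitions, `covers` says at once that the pairs are disjoint and that
  -- `free` lists exactly the unmatched coordinates.
  record State : Set where
    field
      pairs         : List (Index × Index)
      free          : List Index
      covers        : flat pairs ++ free ↭ universe
      monochromatic : All Monochromatic pairs
      independent   : Independent pairs
  open State

  -- Records only the effect on the free list, because the energy of the descent depends on nothing
  -- else; old pairs may have been rearranged.
  Releases : Class → List Index → List Index → Set
  Releases C xs ys = ∃₂ λ u v → class u ≡ C × class v ≡ C × xs ↭ u ∷ v ∷ ys

  -- Adding a pair to a class

  join : ∀ (st : State) {C u v rest a} → class u ≡ C → class v ≡ C → free st ↭ u ∷ v ∷ rest →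
         Annihilates a (pairs st) → gap (u , v) a ≡ true →
         Σ State λ st′ → Releases C (free st) (free st′)
  join st {u = u} {v} {rest} cu cv ρ ann eq = st′ , u , v , cu , cv , ρ
    where
    st′ : State
    st′ = record
      { pairs = (u , v) ∷ pairs st
      ; free = rest
      ; covers = ↭-trans (shifts (u ∷ v ∷ []) (flat (pairs st)))
                         (↭-trans (++⁺ˡ (flat (pairs st)) (↭-sym ρ)) (covers st))
      ; monochromatic = ≡.trans cu (sym cv) ∷ monochromatic st
      ; independent = independent-∷ (independent st) ann eq
      }

  remove : ∀ (st : State) {i j ps} → pairs st ↭ (i , j) ∷ ps → State
  remove st {i} {j} {ps} ρ = record
    { pairs = ps
    ; free = i ∷ j ∷ free st
    ; covers = ↭-trans (shifts (flat ps) (i ∷ j ∷ []))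
                       (↭-trans (++⁺ʳ (free st) (↭-sym (flat-↭ ρ))) (covers st))
    ; monochromatic = All.tail (All-resp-↭ ρ (monochromatic st))
    ; independent = independent-tail (independent-↭ ρ (independent st))
    }

  -- Replaces the pair ij by iu and jv.  On a and b the two new functionals take the values
  -- (1 , 1) and (x , 1 + x), which are linearly independent.
  rematch : ∀ (st : State) {C i j u v qs rest a b} →
            flat (pairs st) ↭ i ∷ j ∷ flat qs → All Monochromatic qs → Independent qs →
            free st ↭ u ∷ v ∷ rest →
            class i ≡ C → class j ≡ C → class u ≡ C → class v ≡ C →
            Annihilates a qs → gap (i , u) a ≡ true → gap (j , v) a ≡ true →
            Annihilates b qs → gap (i , u) b xor gap (j , v) b ≡ true →
            Σ State λ st′ → Releases C (free st) (free st′)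
  rematch st {i = i} {j} {u} {v} {qs} {rest} {a} {b} ρ mono ind τ ci cj cu cv as iua jva bs eq =
    st′ , u , v , cu , cv , τ
    where
    ind′ : gap (i , u) b xor gap (j , v) b ≡ true → Independent ((i , u) ∷ (j , v) ∷ qs)
    ind′ eq with independent-∷ ind as jva | gap (i , u) b in iub | gap (j , v) b in jvb
    ... | ind₁ | true  | false = independent-∷ ind₁ (jvb ∷ bs) iub
    ... | ind₁ | false | true  =
      independent-∷ ind₁ (ev-+≡ (j , v) jva jvb ∷ +-annihilates as bs) (ev-+≡ (i , u) iua iub)
    st′ : State
    st′ = record
      { pairs = (i , u) ∷ (j , v) ∷ qs
      ; free = rest
      ; covers = ↭-trans (↭-prep i (↭-trans (↭-swap u j ↭-refl) (↭-prep j (shifts (u ∷ v ∷ []) (flat qs)))))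
                         (↭-trans (++⁺ (↭-sym ρ) (↭-sym τ)) (covers st))
      ; monochromatic = ≡.trans ci (sym cu) ∷ ≡.trans cj (sym cv) ∷ mono
      ; independent = ind′ eq
      }

  -- Some `k` among `i`, `j` differs from a free `u` of the class at `a`. If the free `u`, `v`, `w`
  -- are not all equal at `a`, two of them are joined; if `k` is free, it joins `u`. Otherwise `k`
  -- has a partner `l`, equal to `k` at `a` since `a` kills the pair, and this pair is traded for
  -- two that match `k` and `l` with free coordinates.
  gain : ∀ (st : State) {C a i j} → 3 ≤ size C (free st) → Annihilates a (pairs st) →
         class i ≡ C → class j ≡ C → gap (i , j) a ≡ true →
         Σ State λ st′ → Releases C (free st) (free st′)
  gain st {C} {a} {i} {j} 3≤ as ci cj ija
    with u , xs , Cu , ρu , 2≤ ← count-pick (within C) (free st) 3≤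
    with v , ys , Cv , ρv , 1≤ ← count-pick (within C) xs 2≤
    with w , zs , Cw , ρw , _ ← count-pick (within C) ys 1≤
    with cu ← within⇒≡ C u Cu | cv ← within⇒≡ C v Cv | cw ← within⇒≡ C w Cw
    = goal
    where
    Goal : Set
    Goal = Σ State λ st′ → Releases C (free st) (free st′)

    ρ : free st ↭ u ∷ v ∷ w ∷ zs
    ρ = ↭-trans ρu (↭-prep u (↭-trans ρv (↭-prep v ρw)))

    via : ∀ {k x y a s t} → gap (k , x) a ≡ s → gap (x , y) a ≡ t → gap (k , y) a ≡ s xor t
    via {k} {x} {y} {a} refl refl = xor-via (φ k a) (φ x a) (φ y a)

    across : ∀ {k l x y b} → gap (k , l) b ≡ true → gap (x , y) b ≡ false →
             gap (k , x) b xor gap (l , y) b ≡ true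
    across {k} {l} {x} {y} {b} klb xyb =
      ≡.trans (xor-interchange (φ k b) (φ x b) (φ l b) (φ y b)) (cong₂ _xor_ klb xyb)

    exchange : ∀ {k l qs b} → class k ≡ C → class l ≡ C → flat (pairs st) ↭ k ∷ l ∷ flat qs →
               All Monochromatic qs → Independent qs → Annihilates a qs →
               gap (k , u) a ≡ true → gap (l , u) a ≡ true →
               gap (u , v) a ≡ false → gap (u , w) a ≡ false →
               Annihilates b qs → gap (k , l) b ≡ true → Goal
    exchange {k} {l} {b = b} ck cl τ mono ind as kua lua uva uwa bs klb
      -- The trade needs two of `u`, `v`, `w` that agree at `b`, where `k` and `l` differ. Among
      -- three bits two always agree, hence the three free coordinates.
      with gap (u , v) b in uvb | gap (u , w) b in uwb
    ... | false | _ = rematch st τ mono ind ρ ck cl cu cv as kua (via lua uva) bs (across klb uvb)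
    ... | true | false =
      rematch st τ mono ind (↭-trans ρ (↭-prep u (↭-swap v w ↭-refl)))
        ck cl cu cw as kua (via lua uwa) bs (across klb uwb)
    ... | true | true =
      rematch st τ mono ind (↭-trans ρ (shifts (u ∷ []) (v ∷ w ∷ [])))
        ck cl cv cw as (via kua uva) (via lua uwa) bs
        (across klb (via (≡.trans (xor-comm (φ v b) (φ u b)) uvb) uwb))

    matched : ∀ {k} → class k ≡ C → gap (k , u) a ≡ true →
              gap (u , v) a ≡ false → gap (u , w) a ≡ false →
              ∃[ l ] ((k , l) ∈ pairs st ⊎ (l , k) ∈ pairs st) → Goal
    matched {k} ck kua uva uwa (l , inj₁ m)
      with qs , τ ← pick m
      with b , klb , bs ← independent st τ
         | kl ∷ mono ← All-resp-↭ τ (monochromatic st)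
         | kla ∷ as ← All-resp-↭ τ as
      = exchange ck (≡.trans (sym kl) ck) (flat-↭ τ) mono
          (independent-tail (independent-↭ τ (independent st))) as
          kua (via (≡.trans (xor-comm (φ l a) (φ k a)) kla) kua) uva uwa bs klb
    matched {k} ck kua uva uwa (l , inj₂ m)
      with qs , τ ← pick m
      with b , lkb , bs ← independent st τ
         | lk ∷ mono ← All-resp-↭ τ (monochromatic st)
         | lka ∷ as ← All-resp-↭ τ as
      = exchange ck (≡.trans lk ck) (↭-trans (flat-↭ τ) (↭-swap l k ↭-refl)) mono
          (independent-tail (independent-↭ τ (independent st))) as
          kua (via lka kua) uva uwa bs (≡.trans (xor-comm (φ k b) (φ l b)) lkb)

    unmatched : ∀ {k} → class k ≡ C → gap (k , u) a ≡ true → k ∈ u ∷ v ∷ w ∷ zs → Goal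
    unmatched ck kua (here refl) = contradiction (≡.trans (sym kua) (xor-same (φ u a))) λ ()
    unmatched {k} ck kua (there m) with rest , τ ← pick m =
      join st cu ck (↭-trans ρ (↭-prep u τ)) as (≡.trans (xor-comm (φ u a) (φ k a)) kua)

    from : ∀ {k} → class k ≡ C → gap (k , u) a ≡ true → Goal
    from {k} ck kua with gap (u , v) a in uva | gap (u , w) a in uwa
    ... | true | _ = join st cu cv ρ as uva
    ... | false | true = join st cu cw (↭-trans ρ (↭-prep u (↭-swap v w ↭-refl))) as uwa
    ... | false | false
      with ∈-++⁻ (flat (pairs st)) (∈-resp-↭ (↭-sym (covers st)) (∈-universe k))
    ...   | inj₁ m = matched ck kua uva uwa (∈-flat⁻ (pairs st) m)
    ...   | inj₂ m = unmatched ck kua (∈-resp-↭ ρ m)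

    goal : Goal
    goal with xor-true (φ i a) (φ j a) ija (φ u a)
    ... | inj₁ iua = from ci iua
    ... | inj₂ jua = from cj jua

  -- The dimension count

  select : (Index → Bool) → List Index → List Index
  select P = filter (λ i → P i Bool.≟ true)

  length-select : ∀ P xs → length (select P xs) ≡ count P xs
  length-select P [] = refl
  length-select P (x ∷ xs) with P x
  ... | true  = cong suc (length-select P xs)
  ... | false = length-select P xs

  -- A list of length at most one, since the class may be empty.
  representatives : Bool → Bool → List Index
  representatives s c = take 1 (select (within (s , c)) (side s))

  length-representatives : ∀ s c → length (representatives s c) ≤ 1
  length-representatives s c =
    ℕ.≤-trans (ℕ.≤-reflexive (length-take 1 (select (within (s , c)) (side s)))) (ℕ.m⊓n≤m 1 _)

  representative : ∀ s k → ∃[ h ] h ∈ representatives s (colour (s , k)) × class h ≡ class (s , k)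
  representative s k =
    let inClass? = λ i → within (class (s , k)) i Bool.≟ true
        h , h∈take , h∈ = take₁-inhabited (∈-filter⁺ inClass? (∈-side s k) (≡⇒within (s , k) refl))
    in h , h∈take , within⇒≡ _ h (proj₂ (∈-filter⁻ inClass? {xs = side s} h∈))

  length-side : ∀ s → length (side s) ≡ n
  length-side s = ≡.trans (length-map (s ,_) (allFin n)) (length-tabulate {n = n} (λ k → k))

  tests : (Index → Bool) → Bool → List Index
  tests P s = representatives s false ++ representatives s true ++ select (not ∘ P) (side s)

  length-tests : ∀ P s → length (tests P s) ≤ 2 + count (not ∘ P) (side s)
  length-tests P s = begin
    length (tests P s)
      ≡⟨ length-++ (representatives s false) ⟩
    length (representatives s false) + length (representatives s true ++ select (not ∘ P) (side s))
      ≡⟨ cong (λ m → length (representatives s false) + m) (length-++ (representatives s true)) ⟩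
    length (representatives s false) + (length (representatives s true) + length (select (not ∘ P) (side s)))
      ≤⟨ ℕ.+-mono-≤ (length-representatives s false) (ℕ.+-mono-≤ (length-representatives s true)
           (ℕ.≤-reflexive (length-select (not ∘ P) (side s)))) ⟩
    2 + count (not ∘ P) (side s) ∎
    where open ℕ.≤-Reasoning

  functionals : (Index → Bool) → List (Index × Index) → Bool → List (𝔽₂^ n → Bool)
  functionals P ps s = map gap ps ++ map φ (tests P s)

  length-functionals : ∀ P ps s → length (functionals P ps s) ≤ length ps + (2 + count (not ∘ P) (side s))
  length-functionals P ps s = begin
    length (functionals P ps s)                       ≡⟨ length-++ (map gap ps) ⟩
    length (map gap ps) + length (map φ (tests P s))  ≡⟨ cong₂ _+_ (length-map gap ps) (length-map φ (tests P s)) ⟩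
    length ps + length (tests P s)                    ≤⟨ ℕ.+-monoʳ-≤ (length ps) (length-tests P s) ⟩
    length ps + (2 + count (not ∘ P) (side s))        ∎
    where open ℕ.≤-Reasoning

  -- A vector is determined by its coordinates on side s.  Hence if the pairs ps, one index of
  -- each class and the indices outside P are fewer than n functionals, then some nonzero vector
  -- is killed by all of them, and it is nonconstant on a class inside P.
  nonconstant : ∀ (P : Index → Bool) (ps : List (Index × Index)) s →
                length ps + (2 + count (not ∘ P) (side s)) < n →
                ∃[ a ] ∃₂ λ i j → Annihilates a ps × P i ≡ true × class j ≡ class i ×
                                  gap (i , j) a ≡ true
  nonconstant P ps s few
    with a , b , a≢b , agree ←
           values-collision (functionals P ps s) (ℕ.≤-<-trans (length-functionals P ps s) few)
    with k , diff ← Fin.¬∀⟶∃¬ n _ (λ k → φ (s , k) a Bool.≟ φ (s , k) b) (a≢b ∘ φ-separating s)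
    with h , h∈ , ch ← representative s k
    -- The sum of the colliding vectors is 1 at `(s , k)` but 0 at every test. So `(s , k)` is no
    -- test, which puts it inside `P`, while the representative `h` of its class is one.
    = a +ⱽ b , (s , k) , h ,
      All.map (λ {p} eq → ≡.trans (gap-+ p a b) (xor-cancel eq))
        (map⁻ (++⁻ˡ (map gap ps) agree)) ,
      inside (P (s , k)) refl , ch ,
      cong₂ _xor_ nonzero (vanishes (∈-representatives (colour (s , k)) h∈))
    where
    xor-cancel : ∀ {x y} → x ≡ y → x xor y ≡ false
    xor-cancel {x} refl = xor-same x

    xor-differ : ∀ {x y} → x ≢ y → x xor y ≡ true
    xor-differ {false} {false} x≢y = contradiction refl x≢y
    xor-differ {false} {true}  x≢y = refl
    xor-differ {true}  {false} x≢y = refl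
    xor-differ {true}  {true}  x≢y = contradiction refl x≢y

    nonzero : φ (s , k) (a +ⱽ b) ≡ true
    nonzero = ≡.trans (φ-+ (s , k) a b) (xor-differ diff)

    vanishes : ∀ {i} → i ∈ tests P s → φ i (a +ⱽ b) ≡ false
    vanishes {i} i∈ = ≡.trans (φ-+ i a b)
      (xor-cancel (All.lookup (map⁻ (++⁻ʳ (map gap ps) agree)) i∈))

    ∈-representatives : ∀ c {i} → i ∈ representatives s c → i ∈ tests P s
    ∈-representatives false i∈ = ∈-++⁺ˡ i∈
    ∈-representatives true  i∈ = ∈-++⁺ʳ (representatives s false) (∈-++⁺ˡ i∈)

    inside : ∀ t → P (s , k) ≡ t → P (s , k) ≡ true
    inside true  eq = eq
    inside false eq = contradiction (≡.trans (sym nonzero) (vanishes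
      (∈-++⁺ʳ (representatives s false) (∈-++⁺ʳ (representatives s true)
        (∈-filter⁺ (λ i → not (P i) Bool.≟ true) (∈-side s k) (cong not eq)))))) λ ()

  count-flat : ∀ (P : Index → Bool) (ps : List (Index × Index)) →
               All (λ p → P (proj₁ p) ≡ true × P (proj₂ p) ≡ true) ps →
               count P (flat ps) ≡ length ps + length ps
  count-flat P [] [] = refl
  count-flat P ((i , j) ∷ ps) ((Pi , Pj) ∷ Pps) rewrite Pi | Pj | count-flat P ps Pps =
    cong suc (sym (ℕ.+-suc (length ps) (length ps)))

  -- Averaging over the two sides. The 5 is made of two representatives per side and one more for
  -- strictness.
  short-side : ∀ q x y → (q + q + 5) + (x + y) ≤ n + n → q + (2 + x) < n ⊎ q + (2 + y) < n
  short-side q x y total with q + (2 + x) ℕ.<? n | q + (2 + y) ℕ.<? n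
  ... | yes p | _      = inj₁ p
  ... | no _  | yes p  = inj₂ p
  ... | no p  | no p′  = contradiction (ℕ.≤-trans total (ℕ.+-mono-≤ (ℕ.≮⇒≥ p) (ℕ.≮⇒≥ p′)))
    (ℕ.<⇒≱ (ℕ.≤-reflexive (arithmetic q x y)))
    where
    arithmetic : ∀ q x y → suc ((q + (2 + x)) + (q + (2 + y))) ≡ (q + q + 5) + (x + y)
    arithmetic = solve-∀

  -- The `n + n` indices split into those outside `P` and those inside, among which are both members
  -- of each pair in `qs` and at least five free indices.
  count-total : ∀ (P : Index → Bool) (st : State) {qs rs} → pairs st ↭ qs ++ rs →
                All (λ p → P (proj₁ p) ≡ true × P (proj₂ p) ≡ true) qs → 5 ≤ count P (free st) →
                (length qs + length qs + 5) + (count (not ∘ P) (side false) + count (not ∘ P) (side true)) ≤ n + n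
  count-total P st {qs} {rs} ρ inQ 5≤ = begin
    (length qs + length qs + 5) + (count (not ∘ P) (side false) + count (not ∘ P) (side true))
      ≤⟨ ℕ.+-mono-≤ (ℕ.+-mono-≤ pairs-count 5≤)
           (ℕ.≤-reflexive (sym (count-++ (not ∘ P) (side false) (side true)))) ⟩
    (count P (flat (pairs st)) + count P (free st)) + count (not ∘ P) universe
      ≡⟨ cong (_+ count (not ∘ P) universe)
           (≡.trans (sym (count-++ P (flat (pairs st)) (free st))) (count-↭ P (covers st))) ⟩
    count P universe + count (not ∘ P) universe
      ≡⟨ count-not P universe ⟩
    length universe
      ≡⟨ ≡.trans (length-++ (side false)) (cong₂ _+_ (length-side false) (length-side true)) ⟩
    n + n ∎
    where
    open ℕ.≤-Reasoning
    pairs-count : length qs + length qs ≤ count P (flat (pairs st))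
    pairs-count = begin
      length qs + length qs                  ≡⟨ count-flat P qs inQ ⟨
      count P (flat qs)                      ≤⟨ ℕ.m≤m+n _ _ ⟩
      count P (flat qs) + count P (flat rs)  ≡⟨ count-++ P (flat qs) (flat rs) ⟨
      count P (flat qs ++ flat rs)           ≡⟨ cong (count P) (flat-++ qs rs) ⟨
      count P (flat (qs ++ rs))              ≡⟨ count-↭ P (flat-↭ ρ) ⟨
      count P (flat (pairs st))              ∎

  -- One improvement step

  Improvement : (Class → Bool) → List Index → Set
  Improvement 𝒞 xs = ∃[ C ] 𝒞 C ≡ true × Σ State λ st′ →
    Releases C xs (free st′) ⊎
    (∃₂ λ i j → class i ≡ class j × 𝒞 (class i) ≡ false × Releases C (i ∷ j ∷ xs) (free st′))

  -- Here `a` need only kill `qs`. By `escape`, some vector nonconstant on the class kills all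
  -- pairs, or all but one pair from `rs`. In the latter case that pair is dissolved, and `gain`
  -- applies either way.
  improve-at : ∀ (𝒞 : Class → Bool) (st : State) {qs rs a i j} → pairs st ↭ qs ++ rs →
               All (λ p → 𝒞 (class (proj₁ p)) ≡ false) rs →
               𝒞 (class i) ≡ true → 3 ≤ size (class i) (free st) → class j ≡ class i →
               Annihilates a qs → gap (i , j) a ≡ true → Improvement 𝒞 (free st)
  improve-at 𝒞 st {qs} {rs} {i = i} {j} ρ outR Pi 3≤ cj as ija =
    [ direct , swapped ]′ (escape (gap (i , j)) (gap-+ (i , j)) qs rs (independent-↭ ρ (independent st)) as ija)
    where
    direct : (∃[ b ] Annihilates b (qs ++ rs) × gap (i , j) b ≡ true) → Improvement 𝒞 (free st)
    direct (b , bs , ijb) =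
      let st′ , rel = gain st 3≤ (All-resp-↭ (↭-sym ρ) bs) refl cj ijb
      in class i , Pi , st′ , inj₁ rel
    swapped : (∃[ p ] ∃[ ps ] ∃[ b ] p ∈ rs × qs ++ rs ↭ p ∷ ps × Annihilates b ps × gap (i , j) b ≡ true) →
              Improvement 𝒞 (free st)
    swapped ((k , l) , ps , b , kl∈ , τ , bs , ijb) =
      -- Dissolving a pair only adds free indices, so the bound 3 persists.
      let more = ℕ.≤-trans (ℕ.m≤n+m _ (bit (within (class i) l))) (ℕ.m≤n+m _ (bit (within (class i) k)))
          st′ , rel = gain (remove st (↭-trans ρ τ)) (ℕ.≤-trans 3≤ more) bs refl cj ijb
      in class i , Pi , st′ , inj₂ (k , l ,
           All.lookup (monochromatic st) (∈-resp-↭ (↭-sym ρ) (∈-++⁺ʳ qs kl∈)) ,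
           All.lookup outR kl∈ , rel)

  improve : ∀ (𝒞 : Class → Bool) (st : State) →
            (∀ C → 𝒞 C ≡ true → 3 ≤ size C (free st)) →
            5 ≤ count (𝒞 ∘ class) (free st) → Improvement 𝒞 (free st)
  improve 𝒞 st big 5≤ =
    let qs , rs , ρ , inQ , outR = split (𝒞 ∘ class ∘ proj₁) (pairs st)
        -- The split looks at first members only; pairs are monochromatic, so second members follow.
        inQ² = All.zipWith (λ (Pi , eq) → Pi , ≡.trans (cong 𝒞 (sym eq)) Pi)
                 (inQ , ++⁻ˡ qs (All-resp-↭ ρ (monochromatic st)))
        on-side = λ s few →
          let a , i , j , as , Pi , cj , ija = nonconstant (𝒞 ∘ class) qs s few
          in improve-at 𝒞 st ρ outR Pi (big (class i) Pi) cj as ija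
    in [ on-side false , on-side true ]′
         (short-side (length qs) _ _ (count-total (𝒞 ∘ class) st ρ inQ² 5≤))

  -- Choosing the threshold

  every-class : ∀ {Q : Class → Set} s c → Q (s , c) → Q (s , not c) →
                (∀ c′ → Q (not s , c′)) → ∀ D → Q D
  every-class {Q} s c p q r (s′ , c′) with s′ Bool.≟ s | c′ Bool.≟ c
  ... | yes refl | yes refl = p
  ... | yes refl | no neq   = subst (λ c → Q (s , c)) (sym (¬-not neq)) q
  ... | no neq   | _        = subst (λ s → Q (s , c′)) (sym (¬-not neq)) (r c′)

  -- `3 ≤ θ` serves `gain`, clearness serves `energy-moved`, and the class of size at least 7
  -- supplies the five free indices of the dimension count.
  Threshold : (Class → ℕ) → Set
  Threshold f = ∃[ θ ] 3 ≤ θ × (∀ D → Clear θ (f D)) × (∃[ C ] θ ≤ f C × 7 ≤ f C)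

  -- A class of size 9 passes all four candidates 3, 5, 7, 9, so only the three other classes can
  -- block one.
  large-class : ∀ f s c → 9 ≤ f (s , c) → Threshold f
  large-class f s c 9≤ =
    let j , clear = clear-threshold others
        θ≤ = ℕ.≤-trans (threshold-bound j) 9≤
    in _ , ℕ.m≤m+n 3 _ ,
       every-class s c (inj₁ θ≤) (clear zero) (λ { false → clear (suc zero) ; true → clear (suc (suc zero)) }) ,
       (s , c) , θ≤ , ℕ.≤-trans (ℕ.m≤n+m 7 2) 9≤
    where
    others : Fin 3 → ℕ
    others zero             = f (s , not c)
    others (suc zero)       = f (not s , false)
    others (suc (suc zero)) = f (not s , true)

  -- Both classes of side `s` pass all three candidates 3, 5, 7, and only the two classes of the
  -- other side can block one.
  large-side : ∀ f s → 7 ≤ f (s , false) → 7 ≤ f (s , true) → Threshold f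
  large-side f s 7≤ 7≤′ =
    let j , clear = clear-threshold others
        θ≤7 = threshold-bound j
    in _ , ℕ.m≤m+n 3 _ ,
       every-class s false (inj₁ (ℕ.≤-trans θ≤7 7≤)) (inj₁ (ℕ.≤-trans θ≤7 7≤′))
         (λ { false → clear zero ; true → clear (suc zero) }) ,
       (s , false) , ℕ.≤-trans θ≤7 7≤ , 7≤
    where
    others : Fin 2 → ℕ
    others zero       = f (not s , false)
    others (suc zero) = f (not s , true)

  sum-large : ∀ x y → 15 ≤ x + y → x < 7 → 9 ≤ y
  sum-large x y 15≤ (s≤s x≤6) =
    ℕ.+-cancelˡ-≤ 6 9 y (ℕ.≤-trans 15≤ (ℕ.+-monoˡ-≤ y x≤6))

  -- If one class of the side has at most 6 elements, the other has at least 15 - 6 = 9. This is the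
  -- source of the bound 14 per side, and so of 7 = 14 / 2 in the radius.
  threshold : ∀ f s → 15 ≤ f (s , false) + f (s , true) → Threshold f
  threshold f s 15≤ with 7 ℕ.≤? f (s , false) | 7 ℕ.≤? f (s , true)
  ... | yes p | yes q = large-side f s p q
  ... | no p  | _     = large-class f s true (sum-large (f (s , false)) _ 15≤ (ℕ.≰⇒> p))
  ... | yes _ | no q  = large-class f s false
    (sum-large (f (s , true)) _ (subst (15 ≤_) (ℕ.+-comm (f (s , false)) _) 15≤) (ℕ.≰⇒> q))

  -- Energy and descent

  energy : List Index → ℕ
  energy []       = 0
  energy (i ∷ xs) = size (class i) xs + energy xs

  within-sym : ∀ i j → within (class i) j ≡ within (class j) i
  within-sym i j with class j ≟ class i
  ... | yes eq = sym (≡⇒within i (sym eq))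
  ... | no neq = sym (≢⇒within i (neq ∘ sym))

  energy-↭ : ∀ {xs ys} → xs ↭ ys → energy xs ≡ energy ys
  energy-↭ refl = refl
  energy-↭ (prep i ρ) = cong₂ _+_ (count-↭ (within (class i)) ρ) (energy-↭ ρ)
  energy-↭ (swap {xs} {ys} i j ρ)
    rewrite within-sym i j | sym (energy-↭ ρ)
          | sym (count-↭ (within (class i)) ρ) | sym (count-↭ (within (class j)) ρ) =
    arithmetic (bit (within (class j) i)) (size (class i) xs) (size (class j) xs) (energy xs)
    where
    arithmetic : ∀ b x y e → (b + x) + (y + e) ≡ (b + y) + (x + e)
    arithmetic = solve-∀
  energy-↭ (trans ρ τ) = ≡.trans (energy-↭ ρ) (energy-↭ τ)

  size-∷∷-same : ∀ {C i j} xs → class i ≡ C → class j ≡ C → size C (i ∷ j ∷ xs) ≡ 2 + size C xs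
  size-∷∷-same {i = i} {j} xs ci cj rewrite ≡⇒within i ci | ≡⇒within j cj = refl

  size-∷∷-other : ∀ {C i j} xs → class i ≢ C → class j ≢ C → size C (i ∷ j ∷ xs) ≡ size C xs
  size-∷∷-other {i = i} {j} xs ci cj rewrite ≢⇒within i ci | ≢⇒within j cj = refl

  -- The energy is the sum of m(m - 1)/2 over the class sizes m, and raising m by two adds 2m + 1.
  energy-∷∷ : ∀ {C i j} xs → class i ≡ C → class j ≡ C →
              energy (i ∷ j ∷ xs) ≡ suc (size C xs + size C xs) + energy xs
  energy-∷∷ {C} {i} {j} xs refl cj = ≡.trans
    (cong₂ (λ b D → (bit b + size C xs) + (size D xs + energy xs)) (≡⇒within j cj) cj)
    (cong suc (sym (ℕ.+-assoc (size C xs) (size C xs) (energy xs))))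

  energy-released : ∀ {C xs ys} → Releases C xs ys → energy ys < energy xs
  energy-released {C} {xs} {ys} (u , v , cu , cv , ρ) = begin-strict
    energy ys                                       <⟨ ℕ.m<n+m (energy ys) (s≤s z≤n) ⟩
    suc (size C ys + size C ys) + energy ys         ≡⟨ energy-∷∷ ys cu cv ⟨
    energy (u ∷ v ∷ ys)                             ≡⟨ energy-↭ ρ ⟨
    energy xs                                       ∎
    where open ℕ.≤-Reasoning

  -- With d and c the sizes of `D` and `C` in `xs`, dissolving the pair costs 2d + 1 and the new
  -- pair saves 2(c - 2) + 1, which is more because d + 3 ≤ c.
  energy-moved : ∀ {C D i j xs ys} → class i ≡ D → class j ≡ D → D ≢ C →
                 size D xs + 3 ≤ size C xs → Releases C (i ∷ j ∷ xs) ys → energy ys < energy xs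
  energy-moved {C} {D} {i} {j} {xs} {ys} ci cj D≢C gap≤ (u , v , cu , cv , ρ) =
    ℕ.≰⇒> λ xs≤ys → ℕ.<-irrefl balance (ℕ.+-mono-<-≤ (s≤s (ℕ.+-mono-<-≤ fewer (ℕ.<⇒≤ fewer))) xs≤ys)
    where
    fewer : size D xs < size C ys
    fewer = ℕ.+-cancelˡ-≤ 2 _ _ (begin
      3 + size D xs         ≡⟨ ℕ.+-comm 3 (size D xs) ⟩
      size D xs + 3         ≤⟨ gap≤ ⟩
      size C xs             ≡⟨ size-∷∷-other xs (D≢C ∘ ≡.trans (sym ci)) (D≢C ∘ ≡.trans (sym cj)) ⟨
      size C (i ∷ j ∷ xs)   ≡⟨ count-↭ (within C) ρ ⟩
      size C (u ∷ v ∷ ys)   ≡⟨ size-∷∷-same ys cu cv ⟩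
      2 + size C ys         ∎)
      where open ℕ.≤-Reasoning
    balance : suc (size D xs + size D xs) + energy xs ≡ suc (size C ys + size C ys) + energy ys
    balance = ≡.trans (sym (energy-∷∷ xs ci cj)) (≡.trans (energy-↭ ρ) (energy-∷∷ ys cu cv))

  descend : ∀ (st : State) s → 15 ≤ size (s , false) (free st) + size (s , true) (free st) →
            Σ State λ st′ → energy (free st′) < energy (free st)
  descend st s 15≤ with θ , 3≤θ , clear , C , θ≤C , 7≤C ← threshold (λ D → size D (free st)) s 15≤ =
    finish (improve 𝒞 st (λ D 𝒞D → ℕ.≤-trans 3≤θ (above D 𝒞D)) enough)
    where
    𝒞 : Class → Bool
    𝒞 D = does (θ ℕ.≤? size D (free st))

    above : ∀ D → 𝒞 D ≡ true → θ ≤ size D (free st)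
    above D = does-true (θ ℕ.≤? size D (free st))

    below : ∀ D → 𝒞 D ≡ false → size D (free st) + 3 ≤ θ
    below D 𝒞D with clear D
    ... | inj₁ p = contradiction p (does-false (θ ℕ.≤? size D (free st)) 𝒞D)
    ... | inj₂ p = p

    C∈𝒞 : 𝒞 C ≡ true
    C∈𝒞 = dec-true (θ ℕ.≤? size C (free st)) θ≤C

    enough : 5 ≤ count (𝒞 ∘ class) (free st)
    enough = ℕ.≤-trans (ℕ.≤-trans (ℕ.m≤n+m 5 2) 7≤C)
      (count-mono (λ i i∈C → ≡.trans (cong 𝒞 (within⇒≡ C i i∈C)) C∈𝒞) (free st))

    finish : Improvement 𝒞 (free st) → Σ State λ st′ → energy (free st′) < energy (free st)
    finish (D , _ , st′ , inj₁ rel) = st′ , energy-released rel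
    finish (D , 𝒞D , st′ , inj₂ (i , j , cij , ¬𝒞i , rel)) =
      st′ , energy-moved refl (sym cij)
              (λ eq → contradiction (≡.trans (sym 𝒞D) (≡.trans (cong 𝒞 (sym eq)) ¬𝒞i)) λ ())
              (ℕ.≤-trans (below (class i) ¬𝒞i) (above D 𝒞D)) rel

  Balanced : State → Set
  Balanced st = ∀ s → size (s , false) (free st) + size (s , true) (free st) ≤ 14

  balance : (st : State) → Acc _<_ (energy (free st)) → Σ State Balanced
  balance st (acc rec)
    with size (false , false) (free st) + size (false , true) (free st) ℕ.≤? 14
       | size (true , false) (free st) + size (true , true) (free st) ℕ.≤? 14
  ... | yes p | yes q = st , λ { false → p ; true → q }
  ... | no p  | _     = let st′ , lt = descend st false (ℕ.≰⇒> p) in balance st′ (rec lt)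
  ... | yes _ | no q  = let st′ , lt = descend st true (ℕ.≰⇒> q) in balance st′ (rec lt)

  initial : State
  initial = record
    { pairs = [] ; free = universe ; covers = ↭-refl ; monochromatic = []
    ; independent = λ ρ → contradiction (↭-sym ρ) ¬x∷xs↭[]
    }

  balanced : Σ State Balanced
  balanced = balance initial (<-wellFounded _)

  -- Weights forced by a balanced matching

  onSide : Bool → Index → Bool
  onSide s (s′ , _) = does (s′ Bool.≟ s)

  count-onSide : ∀ y s → count (λ i → onSide s i ∧ y i) universe ≡ count y (side s)
  count-onSide y s = begin
    count (P s) universe                                      ≡⟨ count-++ (P s) (side false) (side true) ⟩
    count (P s) (side false) + count (P s) (side true)        ≡⟨ cong₂ _+_ (count-map (P s) (false ,_) ks) (count-map (P s) (true ,_) ks) ⟩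
    count (P s ∘ (false ,_)) ks + count (P s ∘ (true ,_)) ks  ≡⟨ one-side s ⟩
    count (y ∘ (s ,_)) ks                                     ≡⟨ count-map y (s ,_) ks ⟨
    count y (side s)                                          ∎
    where
    open ≡-Reasoning
    P : Bool → Index → Bool
    P s i = onSide s i ∧ y i
    ks : List (Fin n)
    ks = allFin n
    none : count (λ _ → false) ks ≡ 0
    none = count-none _ (All.universal (λ _ → refl) ks)
    one-side : ∀ s → count (P s ∘ (false ,_)) ks + count (P s ∘ (true ,_)) ks ≡ count (y ∘ (s ,_)) ks
    one-side false = ≡.trans (cong (λ m → count (y ∘ (false ,_)) ks + m) none) (ℕ.+-identityʳ _)
    one-side true  = cong (λ m → m + count (y ∘ (true ,_)) ks) none

  count-side : ∀ s → count (onSide s) universe ≡ n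
  count-side s = begin
    count (onSide s) universe
      ≡⟨ cong sum (map-cong (λ i → cong bit (sym (Bool.∧-identityʳ (onSide s i)))) universe) ⟩
    count (λ i → onSide s i ∧ true) universe     ≡⟨ count-onSide (λ _ → true) s ⟩
    count (λ _ → true) (side s)                  ≡⟨ count-all (side s) ⟩
    length (side s)                              ≡⟨ length-side s ⟩
    n                                            ∎
    where
    open ≡-Reasoning
    count-all : (xs : List Index) → count (λ _ → true) xs ≡ length xs
    count-all []       = refl
    count-all (_ ∷ xs) = cong suc (count-all xs)

  count-onSide≤ : ∀ s xs → count (onSide s) xs ≤ size (s , false) xs + size (s , true) xs
  count-onSide≤ s = count-cover cover
    where
    cover : ∀ i → onSide s i ≡ true → within (s , false) i ≡ true ⊎ within (s , true) i ≡ true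
    cover i@(s′ , _) eq = by-colour (colour i) refl
      where
      by-colour : ∀ c → colour i ≡ c → within (s , false) i ≡ true ⊎ within (s , true) i ≡ true
      by-colour false c = inj₁ (≡⇒within i (cong₂ _,_ (does-true (s′ Bool.≟ s) eq) c))
      by-colour true  c = inj₂ (≡⇒within i (cong₂ _,_ (does-true (s′ Bool.≟ s) eq) c))

  -- Each pair lies in `S` entirely or not at all, and `y` holds on exactly one of its members.
  count-differing : ∀ (S y : Index → Bool) ps →
    All (λ (i , j) → S i ≡ S j × y i xor y j ≡ true) ps →
    let w = count (λ i → S i ∧ y i) (flat ps) in count S (flat ps) ≤ w + w
  count-differing S y [] [] = z≤n
  count-differing S y ((i , j) ∷ ps) ((Sij , yij) ∷ rest) rewrite Sij
    with S j | y i | y j | count-differing S y ps rest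
  ... | false | _     | _     | ih = ih
  ... | true  | true  | false | ih = s≤s (ℕ.≤-trans (s≤s ih) (ℕ.≤-reflexive (sym (ℕ.+-suc _ _))))
  ... | true  | false | true  | ih = s≤s (ℕ.≤-trans (s≤s ih) (ℕ.≤-reflexive (sym (ℕ.+-suc _ _))))

  -- At most 14 indices of the side are free. The others form pairs within the side, and `y` holds
  -- on half of them.
  differing-weight : ∀ (st : State) → Balanced st → (y : Index → Bool) →
                     All (λ (i , j) → y i xor y j ≡ true) (pairs st) →
                     ∀ s → let w = count y (side s) in n ≤ w + w + 14
  differing-weight st bal y differ s = begin
    n                                                   ≡⟨ count-side s ⟨
    count S universe                                    ≡⟨ count-↭ S (covers st) ⟨
    count S (flat (pairs st) ++ free st)                ≡⟨ count-++ S (flat (pairs st)) (free st) ⟩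
    count S (flat (pairs st)) + count S (free st)
      ≤⟨ ℕ.+-mono-≤ (count-differing S y (pairs st) sameSide)
                     (ℕ.≤-trans (count-onSide≤ s (free st)) (bal s)) ⟩
    count Sy (flat (pairs st)) + count Sy (flat (pairs st)) + 14
      ≤⟨ ℕ.+-monoˡ-≤ 14 (ℕ.+-mono-≤ part≤ part≤) ⟩
    count y (side s) + count y (side s) + 14            ∎
    where
    open ℕ.≤-Reasoning
    S Sy : Index → Bool
    S = onSide s
    Sy i = S i ∧ y i
    sameSide : All (λ (i , j) → S i ≡ S j × y i xor y j ≡ true) (pairs st)
    sameSide = All.zipWith (λ (eq , yij) → cong (λ C → does (proj₁ C Bool.≟ s)) eq , yij)
                           (monochromatic st , differ)
    part≤ : count Sy (flat (pairs st)) ≤ count y (side s)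
    part≤ = begin
      count Sy (flat (pairs st))                           ≤⟨ ℕ.m≤m+n _ _ ⟩
      count Sy (flat (pairs st)) + count Sy (free st)      ≡⟨ count-++ Sy (flat (pairs st)) (free st) ⟨
      count Sy (flat (pairs st) ++ free st)                ≡⟨ count-↭ Sy (covers st) ⟩
      count Sy universe                                    ≡⟨ count-onSide y s ⟩
      count y (side s)                                     ∎

  -- Independence lets `a` be chosen with `gap (i , j) a` equal to 1 + `o i` + `o j`, so
  -- `φ i a xor o i` differs on the two members of every pair. Each pair has one colour, so its gap
  -- vanishes at `z` and `a +ⱽ z` inherits the property.
  far-vector : ∀ z → (∀ i → φ i z ≡ colour i) → (o : Index → Bool) →
    let w = λ a s → count (λ i → φ i a xor o i) (side s) in
    ∃[ a ] ∀ s → n ≤ w a s + w a s + 14 × n ≤ w (a +ⱽ z) s + w (a +ⱽ z) s + 14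
  far-vector z φz o =
    let st , bal = balanced
        a , as = independent⇒solvable (pairs st) (independent st) (λ (i , j) → not (o i xor o j))
        a+zs = All.zipWith (λ {p} (eq , mono) → shift-z p eq mono) (as , monochromatic st)
    in a , λ s → differing-weight st bal _ (All.map (λ {p} → differ p) as) s ,
                 differing-weight st bal _ (All.map (λ {p} → differ p) a+zs) s
    where
    differ : ∀ ((i , j) : Index × Index) {a} → gap (i , j) a ≡ not (o i xor o j) →
             (φ i a xor o i) xor (φ j a xor o j) ≡ true
    differ (i , j) {a} eq = ≡.trans (xor-interchange (φ i a) (o i) (φ j a) (o j))
      (≡.trans (cong (_xor (o i xor o j)) eq) (Bool.xor-inverseˡ (o i xor o j)))
    shift-z : ∀ ((i , j) : Index × Index) {a t} → gap (i , j) a ≡ t → class i ≡ class j →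
              gap (i , j) (a +ⱽ z) ≡ t
    shift-z (i , j) {a} eq mono = ≡.trans (gap-+ (i , j) a z)
      (≡.trans (cong₂ _xor_ eq gap-z) (Bool.xor-identityʳ _))
      where
      gap-z : gap (i , j) z ≡ false
      gap-z rewrite φz i | φz j | cong proj₂ mono = xor-same (colour j)

-- Hamming distances and comparison with the radius

dist-count : ∀ {n} (x y : 𝔽₂^ n) →
             count (λ k → Vec.lookup y k xor Vec.lookup x k) (allFin n) ≡ d x y
dist-count {n} x y = ≡.trans
  (cong sum (map-tabulate {n = n} (λ k → k) (λ k → bit (Vec.lookup y k xor Vec.lookup x k)))) (go x y)
  where
  go : ∀ {n} (x y : 𝔽₂^ n) → sum (tabulate (λ k → bit (Vec.lookup y k xor Vec.lookup x k))) ≡ d x y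
  go [] [] = refl
  go (false ∷ x) (false ∷ y) = go x y
  go (false ∷ x) (true  ∷ y) = cong suc (go x y)
  go (true  ∷ x) (false ∷ y) = cong suc (go x y)
  go (true  ∷ x) (true  ∷ y) = go x y

lookup-injective : ∀ {n} {a b : 𝔽₂^ n} → (∀ k → Vec.lookup a k ≡ Vec.lookup b k) → a ≡ b
lookup-injective {a = a} {b} eq =
  ≡.trans (sym (Vec.tabulate∘lookup a)) (≡.trans (Vec.tabulate-cong eq) (Vec.tabulate∘lookup b))

+ⱽ-cancel : ∀ {n} (a z : 𝔽₂^ n) → a +ⱽ (a +ⱽ z) ≡ z
+ⱽ-cancel [] [] = refl
+ⱽ-cancel (x ∷ a) (y ∷ z) = cong₂ _∷_ (cancel x y) (+ⱽ-cancel a z)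
  where
  cancel : ∀ x y → x xor (x xor y) ≡ y
  cancel false y = refl
  cancel true  y = Bool.not-involutive y

-- Roundedness gives upward closure of the upper cut along strict inequalities; equality is split
-- off.
<ℝ-≤-trans : ∀ r {p q} → r <ℝ p → p ℚ.≤ q → r <ℝ q
<ℝ-≤-trans r {p} {q} r<p p≤q with q ℚ.≤? p
... | yes q≤p = subst (r <ℝ_) (ℚ.≤-antisym p≤q q≤p) r<p
... | no q≰p  = Equivalence.from (ℝ.upper-rounded r q) (p , ℚ.≰⇒> q≰p , r<p)

-- The inequality n/2 - 7 ≤ w after cross-multiplying the unnormalised fractions.
2[n/2-7]≤2w : ∀ n w → n ≤ w + w + 14 →
  (+ n ℤ.* + 1 ℤ.+ ℤ.- + 7 ℤ.* + 2) ℤ.* + 1 ℤ.≤ + w ℤ.* + 2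
2[n/2-7]≤2w n w n≤ = begin
  (+ n ℤ.* + 1 ℤ.+ ℤ.- + 14) ℤ.* + 1   ≡⟨ ℤ.*-identityʳ _ ⟩
  + n ℤ.* + 1 ℤ.+ ℤ.- + 14             ≡⟨ cong (ℤ._+ ℤ.- + 14) (ℤ.*-identityʳ (+ n)) ⟩
  + n ℤ.+ ℤ.- + 14                     ≤⟨ ℤ.+-monoˡ-≤ (ℤ.- + 14) (ℤ.+≤+ n≤) ⟩
  + (w + w + 14) ℤ.+ ℤ.- + 14          ≡⟨ ℤ.+-assoc (+ (w + w)) (+ 14) (ℤ.- + 14) ⟩
  + (w + w) ℤ.+ + 0                    ≡⟨ ℤ.+-identityʳ (+ (w + w)) ⟩
  + (w + w)                            ≡⟨ cong +_ (double w) ⟩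
  + (w * 2)                            ≡⟨ ℤ.pos-* w 2 ⟩
  + w ℤ.* + 2                          ∎
  where
  open ℤ.≤-Reasoning
  double : ∀ w → w + w ≡ w * 2
  double = solve-∀

n/2-7≤w : ∀ n w → n ≤ w + w + 14 → (+ n) / 2 - (+ 7) / 1 ℚ.≤ (+ w) / 1
n/2-7≤w n w n≤ = ℚ.toℚᵘ-cancel-≤ (begin
  toℚᵘ ((+ n) / 2 - (+ 7) / 1)        ≃⟨ ℚ.toℚᵘ-homo-+ ((+ n) / 2) (ℚ.- ((+ 7) / 1)) ⟩
  toℚᵘ ((+ n) / 2) ℚᵘ.- mkℚᵘ (+ 7) 0  ≃⟨ ℚᵘ.+-congˡ _ (ℚ.toℚᵘ-fromℚᵘ (mkℚᵘ (+ n) 1)) ⟩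
  mkℚᵘ (+ n) 1 ℚᵘ.- mkℚᵘ (+ 7) 0      ≤⟨ ℚᵘ.*≤* (2[n/2-7]≤2w n w n≤) ⟩
  mkℚᵘ (+ w) 0                        ≃⟨ ℚ.toℚᵘ-fromℚᵘ (mkℚᵘ (+ w) 0) ⟨
  toℚᵘ ((+ w) / 1)                    ∎)
  where open ℚᵘ.≤-Reasoning

theorem1 : ∃[ n₀ ] ∀ (n : ℕ) → n ≥ n₀ →
    ∀ (L : 𝔽₂^ n → 𝔽₂^ n) →
    IsLeftModuleIsomorphism (𝔽₂^-rawLeftModule n) (𝔽₂^-rawLeftModule n) L →
    ∀ (x₁ x₂ : 𝔽₂^ n) (r : ℝ) →
    r <ℝ (+ n) / 2 - (+ 7) / 1 →
    let A₁ = B r x₁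
        A₂ = image L (B r x₂)
    in
    ∀ (S : Pred (𝔽₂^ n) 0ℓ) →
    U ≐ A₁ ∪ A₂ ∪ S →
    S ⊕ S ≐ U
-- The counting is uniform in `n`, which gives the witness 0.
theorem1 = 0 , λ n _ L iso x₁ x₂ r r< S cover →
  (λ _ → tt) , λ {z} _ → sumset n L iso x₁ x₂ r r< S cover z
  where
  sumset : ∀ n (L : 𝔽₂^ n → 𝔽₂^ n) →
    IsLeftModuleIsomorphism (𝔽₂^-rawLeftModule n) (𝔽₂^-rawLeftModule n) L →
    ∀ (x₁ x₂ : 𝔽₂^ n) (r : ℝ) → r <ℝ (+ n) / 2 - (+ 7) / 1 →
    (S : Pred (𝔽₂^ n) 0ℓ) → U ≐ B r x₁ ∪ image L (B r x₂) ∪ S → ∀ z → (S ⊕ S) z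
  sumset n L iso x₁ x₂ r r< S cover z =
    let a , far = far-vector z (λ _ → refl) o
    in a , a +ⱽ z ,
       inS a (proj₁ (far false)) (proj₁ (far true)) ,
       inS (a +ⱽ z) (proj₂ (far false)) (proj₂ (far true)) ,
       +ⱽ-cancel a z
    where
    open IsLeftModuleIsomorphism iso using (injective; surjective; +ᴹ-homo)
    M : 𝔽₂^ n → 𝔽₂^ n
    M y = proj₁ (surjective y)

    L∘M : ∀ y → L (M y) ≡ y
    L∘M y = proj₂ (surjective y) refl

    M-+ : ∀ a b → M (a +ⱽ b) ≡ M a +ⱽ M b
    M-+ a b = injective (≡.trans (L∘M (a +ⱽ b))
      (sym (≡.trans (+ᴹ-homo (M a) (M b)) (cong₂ _+ⱽ_ (L∘M a) (L∘M b)))))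

    frame : Bool → 𝔽₂^ n → 𝔽₂^ n
    frame false a = a
    frame true  a = M a

    φ : Bool × Fin n → 𝔽₂^ n → Bool
    φ (s , k) a = Vec.lookup (frame s a) k

    frame-+ : ∀ s a b → frame s (a +ⱽ b) ≡ frame s a +ⱽ frame s b
    frame-+ false a b = refl
    frame-+ true  a b = M-+ a b

    frame-injective : ∀ s {a b} → frame s a ≡ frame s b → a ≡ b
    frame-injective false eq = eq
    frame-injective true {a} {b} eq = ≡.trans (sym (L∘M a)) (≡.trans (cong L eq) (L∘M b))

    φ-+ : ∀ i a b → φ i (a +ⱽ b) ≡ φ i a xor φ i b
    φ-+ (s , k) a b = ≡.trans (cong (λ v → Vec.lookup v k) (frame-+ s a b))
      (Vec.lookup-zipWith _xor_ k (frame s a) (frame s b))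

    open Matching φ φ-+ (λ s eq → frame-injective s (lookup-injective eq)) (λ i → φ i z)

    centre : Bool → 𝔽₂^ n
    centre false = x₁
    centre true  = x₂

    -- With this offset, the ones of `φ i y xor o i` on a side count the distance from `frame s y`
    -- to the centre.
    o : Index → Bool
    o (s , k) = Vec.lookup (centre s) k

    beyond : ∀ s y → let w = count (λ i → φ i y xor o i) (side s) in
             n ≤ w + w + 14 → r <ℝ (+ d (centre s) (frame s y)) / 1
    beyond s y n≤ = <ℝ-≤-trans r r< (n/2-7≤w n (d (centre s) (frame s y)) (subst (λ w → n ≤ w + w + 14)
      (≡.trans (count-map _ (s ,_) (allFin n)) (dist-count (centre s) (frame s y))) n≤))

    inS : ∀ y → (let w = count (λ i → φ i y xor o i) (side false) in n ≤ w + w + 14) →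
                (let w = count (λ i → φ i y xor o i) (side true) in n ≤ w + w + 14) → S y
    inS y n≤ n≤′ with proj₁ cover {y} tt
    ... | inj₁ y∈A₁ = contradiction (beyond false y n≤) y∈A₁
    -- Here `y` is `L x`, and `M (L x)` equals `x` by injectivity, so the bound on side `true`
    -- concerns `x` itself.
    ... | inj₂ (inj₁ (x , x∈B , refl)) = contradiction
      (subst (λ v → r <ℝ (+ d x₂ v) / 1) (injective (L∘M (L x))) (beyond true (L x) n≤′)) x∈B
    ... | inj₂ (inj₂ y∈S) = y∈S
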